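{- Let $X$ be a join space. Then $X$ is projective if and only if $X$ is dense and join-transitive and the pair consisting of $X$ and the set of join-closed subsets of $X$ is a matroid.
   Context: A join space is a set $X$ with a ternary relation $\langle\cdot,\cdot,\cdot\rangle$ on $X$ such that: $\langle a,x,x\rangle$ for all $a,x\in X$; $\langle x,b,y\rangle$ implies $\langle y,b,x\rangle$ for all $x,b,y\in X$; and $\langle x,y,x\rangle$ implies $y=x$ for all $x,y\in X$. For $a,c\in X$ put $ac:=\{x\in X\mid\langle a,x,c\rangle\}$. For $A\subseteq X$ and $x,y\in X$, $\langle A,x,y\rangle$ means that there is $a\in A$ with $\langle a,x,y\rangle$. $X$ is transitive iff for all $a,b,c\in X$, $\langle a,b,c\rangle$ implies $ab\subseteq ac$. $X$ is symmetric iff for all $a,b,c\in X$, $\langle a,b,c\rangle$ and $a\neq b$ imply $\langle a,c,b\rangle$. $X$ is equivalence-relational iff it is transitive and symmetric. $X$ is join-transitive iff for all $a,b\in X$, with $A:=ab$, the binary relation $\langle A,\cdot,\cdot\rangle$ is transitive on $X$. $X$ is preprojective iff it is equivalence-relational and for all $a,b,c,d\in X$: if $b=c$ or $a=d$ or $bc\cap ad\neq\emptyset$, then $a=b$ or $c=d$ or $ab\cap cd\neq\emptyset$. $X$ is dense iff for all $a,b\in X$ with $a\neq b$, $ab\setminus\{a,b\}\neq\emptyset$. $X$ is projective iff it is preprojective and dense. A subset $C\subseteq X$ is join-closed iff $ab\subseteq C$ for all $a,b\in C$. A closure space is a pair $(X,C)$ where $X$ is a set and $C$ is a set of subsets of $X$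 (called closed sets) with $X\in C$ and $\bigcap D\in C$ for every non-empty $D\subseteq C$. For $A\subseteq X$, $\mathrm{cl}(A)$ is the smallest closed superset of $A$, and $\vdash_A$ is the binary relation on $X$ given by $x\vdash_A y:\Leftrightarrow y\in\mathrm{cl}(A\cup\{x\})$. $(X,C)$ is an exchange space iff for each closed $A\subseteq X$ the relation $\vdash_A$ is symmetric on $X\setminus A$. $(X,C)$ is combinatorial iff $\bigcup D\in C$ for each non-empty chain $D\subseteq C$ (with respect to inclusion). A matroid is a combinatorial exchange space (not necessarily finite). -}

module Defs where

open import Level using (Level; _⊔_; suc)
open import Data.Product using (Σ; ∃; _×_; proj₁)
open import Data.Sum using (_⊎_)
open import Data.Unit.Polymorphic using (⊤)
open import Relation.Binary.Core using (Rel)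
open import Relation.Binary.Definitions using (Transitive)
open import Relation.Binary.PropositionalEquality using (_≡_; _≢_)
open import Relation.Unary
  using (Pred; _∈_; _∉_; _⊆_; _≐_; _∪_; _∩_; _∖_; ｛_｝; ⋃; ⋂; Satisfiable)

-- Subsets of X are predicates at a fixed level p, and a set of subsets of X is
-- a predicate on those. Unions and intersections of sets of subsets land in a
-- higher level than p, so "the union of D belongs to C" is expressed as: every
-- subset with the same elements as the union of D belongs to C. Under excluded
-- middle such a subset always exists, because every predicate on X is then
-- equivalent to a Boolean-valued one.

module _ {a p c : Level} {X : Set a} (C : Pred (Pred X p) c) where

  -- The level of families is that of Pred X p, so singletons such as (S ≡_)
  -- are among them.
  Family : Set (suc a ⊔ suc (suc p))
  Family = Pred (Pred X p) (a ⊔ suc p)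

  -- Closure under the intersections of the singletons (S ≡_) also says that C
  -- respects extensional equality of subsets.
  record IsClosureSpace : Set (suc a ⊔ suc (suc p) ⊔ c) where
    field
      whole-closed        : (λ (_ : X) → ⊤ {p}) ∈ C
      intersection-closed : ∀ (D : Family) → D ⊆ C → Satisfiable D →
                            ∀ S → S ≐ ⋂ (∃ D) proj₁ → S ∈ C

  -- The smallest closed superset of A, as the intersection of all of them.
  cl : ∀ {q} → Pred X q → Pred X (a ⊔ suc p ⊔ c ⊔ q)
  cl A = ⋂ (Σ (Pred X p) λ S → S ∈ C × A ⊆ S) proj₁

  -- Entails A x y is  x ⊢_A y.
  Entails : ∀ {q} → Pred X q → Rel X (a ⊔ suc p ⊔ c ⊔ q)
  Entails A x y = y ∈ cl (A ∪ ｛ x ｝)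

  IsExchange : Set (a ⊔ suc p ⊔ c)
  IsExchange = ∀ A → A ∈ C → ∀ x y → x ∉ A → y ∉ A →
               Entails A x y → Entails A y x

  IsChain : Family → Set (a ⊔ suc p)
  IsChain D = ∀ S T → S ∈ D → T ∈ D → S ⊆ T ⊎ T ⊆ S

  IsCombinatorial : Set (suc a ⊔ suc (suc p) ⊔ c)
  IsCombinatorial = ∀ (D : Family) → D ⊆ C → Satisfiable D → IsChain D →
                    ∀ S → S ≐ ⋃ (∃ D) proj₁ → S ∈ C

  record IsMatroid : Set (suc a ⊔ suc (suc p) ⊔ c) where
    field
      isClosureSpace  : IsClosureSpace
      isExchange      : IsExchange
      isCombinatorial : IsCombinatorial

record JoinSpace (a r : Level) : Set (suc (a ⊔ r)) where
  field
    Carrier   : Set a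
    ⟨_,_,_⟩   : Carrier → Carrier → Carrier → Set r
    endpoint  : ∀ a x → ⟨ a , x , x ⟩
    reversal  : ∀ x b y → ⟨ x , b , y ⟩ → ⟨ y , b , x ⟩
    collapse  : ∀ x y → ⟨ x , y , x ⟩ → y ≡ x

module _ {a r : Level} (X : JoinSpace a r) where
  open JoinSpace X

  -- The set written  ac  on paper.
  join : Carrier → Carrier → Pred Carrier r
  join a c x = ⟨ a , x , c ⟩

  -- From A x y is  ⟨A,x,y⟩.
  From : ∀ {q} → Pred Carrier q → Rel Carrier (a ⊔ r ⊔ q)
  From A x y = ∃ λ a → a ∈ A × ⟨ a , x , y ⟩

  IsTransitive : Set (a ⊔ r)
  IsTransitive = ∀ a b c → ⟨ a , b , c ⟩ → join a b ⊆ join a c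

  IsSymmetric : Set (a ⊔ r)
  IsSymmetric = ∀ a b c → ⟨ a , b , c ⟩ → a ≢ b → ⟨ a , c , b ⟩

  IsEquivalenceRelational : Set (a ⊔ r)
  IsEquivalenceRelational = IsTransitive × IsSymmetric

  IsJoinTransitive : Set (a ⊔ r)
  IsJoinTransitive = ∀ a b → Transitive (From (join a b))

  IsPreprojective : Set (a ⊔ r)
  IsPreprojective =
    IsEquivalenceRelational ×
    (∀ a b c d →
      b ≡ c ⊎ a ≡ d ⊎ Satisfiable (join b c ∩ join a d) →
      a ≡ b ⊎ c ≡ d ⊎ Satisfiable (join a b ∩ join c d))

  IsDense : Set (a ⊔ r)
  IsDense = ∀ a b → a ≢ b → Satisfiable (join a b ∖ (｛ a ｝ ∪ ｛ b ｝))

  IsProjective : Set (a ⊔ r)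
  IsProjective = IsPreprojective × IsDense

  -- As a set of subsets, at the least level at which every join is a subset
  -- and every singleton is one.
  JoinClosed : Pred (Pred Carrier (a ⊔ r)) (a ⊔ r)
  JoinClosed C = ∀ a b → a ∈ C → b ∈ C → join a b ⊆ C

{-# OPTIONS --safe #-}

-- In an equivalence-relational join space the joins of distinct points are the
-- lines of a linear space, and the preprojective condition is the Veblen–Young
-- axiom for them.
--
-- Left to right, that axiom makes ⟨A,·,·⟩ transitive for every join-closed A.
-- By a second use of it, {x} together with all joins ax, a ∈ A, is join-closed, so
-- it is cl(A ∪ {x}), and exchange is the symmetry of the space.
--
-- Right to left, join-transitivity over aa = {a} is transitivity. It also makes
-- every join join-closed, so that cl{a,b} = ab and exchange over {a} gives
-- symmetry. If e lies on both bc and ad, then c ≤ e ≤ d for the relation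
-- ≤ := ⟨ab,·,·⟩, and c ≤ d provides a common point of ab and cd.
module Submission where

open import Level using (Level; _⊔_; suc; Lift; lift; lower)
open import Data.Product using (_×_; _,_; proj₁; proj₂)
open import Data.Sum using (_⊎_; inj₁; inj₂)
open import Function.Base using (_∘_)
open import Function.Bundles using (_⇔_; mk⇔)
open import Axiom.ExcludedMiddle using (ExcludedMiddle)
open import Relation.Binary.Definitions using (DecidableEquality; Transitive)
open import Relation.Binary.PropositionalEquality using (_≡_; _≢_; refl; sym)
open import Relation.Nullary using (yes; no)
open import Relation.Nullary.Decidable using (map′)
open import Relation.Unary using (Pred; _∈_; _⊆_; _∪_; _∩_; ｛_｝; Satisfiable)
open import Defs

module _ {a r : Level} (X : JoinSpace a r) where
  open JoinSpace X

  -- Level-polymorphic, since joins live at level `r` while `JoinClosed` fixes `a ⊔ r`.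
  IsJoinClosed : ∀ {q} → Pred Carrier q → Set (a ⊔ r ⊔ q)
  IsJoinClosed C = ∀ x y → x ∈ C → y ∈ C → join X x y ⊆ C

  startpoint : ∀ x y → ⟨ x , x , y ⟩
  startpoint x y = reversal y x x (endpoint y x)

  joinClosed-isClosureSpace : IsClosureSpace (JoinClosed X)
  joinClosed-isClosureSpace = record
    { whole-closed        = λ _ _ _ _ _ → _
    ; intersection-closed = λ D D⊆C _ S (S⊆⋂ , ⋂⊆S) x y x∈S y∈S z∈xy →
        ⋂⊆S λ (T , T∈D) →
          D⊆C T∈D x y (S⊆⋂ x∈S (T , T∈D)) (S⊆⋂ y∈S (T , T∈D)) z∈xy
    }

  -- Join-closedness tests two points at a time, and in a chain the larger of two members contains
  -- both.
  joinClosed-isCombinatorial : IsCombinatorial (JoinClosed X)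
  joinClosed-isCombinatorial D D⊆C _ chain S (S⊆⋃ , ⋃⊆S) x y x∈S y∈S z∈xy
    with S⊆⋃ x∈S | S⊆⋃ y∈S
  ... | (T , T∈D) , x∈T | (U , U∈D) , y∈U with chain T U T∈D U∈D
  ...   | inj₁ T⊆U = ⋃⊆S ((U , U∈D) , D⊆C U∈D x y (T⊆U x∈T) y∈U z∈xy)
  ...   | inj₂ U⊆T = ⋃⊆S ((T , T∈D) , D⊆C T∈D x y x∈T (U⊆T y∈U) z∈xy)

  module _ (_≟_ : DecidableEquality Carrier) where

    -- If `x ≢ p`, symmetry puts `y` on xp, so xy ⊆ xp. Hence `q` is on xp, and pq ⊆ px ⊆ xy.
    join-joinClosed : IsEquivalenceRelational X → ∀ x y → IsJoinClosed (join X x y)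
    join-joinClosed (trans , symm) x y p q p∈xy q∈xy {z} z∈pq with x ≟ p
    ... | yes refl = trans x q y q∈xy z∈pq
    ... | no x≢p   = trans x p y p∈xy z∈xp
      where
      q∈xp : ⟨ x , q , p ⟩
      q∈xp = trans x y p (symm x p y p∈xy x≢p) q∈xy
      z∈xp : ⟨ x , z , p ⟩
      z∈xp = reversal p z x (trans p q x (reversal x q p q∈xp) z∈pq)

    module Preprojective (preprojective : IsPreprojective X) where

      private
        trans  = proj₁ (proj₁ preprojective)
        symm   = proj₂ (proj₁ preprojective)
        veblen = proj₂ preprojective
        closed = join-joinClosed (proj₁ preprojective)

      -- The lines fz and ex meet at `y`, so ef and zx meet in some `g`. It lies in `A`, and
      -- symmetry turns g ∈ zx into x ∈ gz.
      From-transitive : ∀ {q} (A : Pred Carrier q) → IsJoinClosed A →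
                        Transitive (From X A)
      From-transitive A A-closed {x} {y} {z} (e , e∈A , x∈ey) (f , f∈A , y∈fz)
        with e ≟ x
      ... | yes refl = e , e∈A , startpoint e z
      ... | no e≢x
        with veblen e f z x (inj₂ (inj₂ (y , y∈fz , symm e x y x∈ey e≢x)))
      ...   | inj₁ refl                      = e , e∈A , trans e y z y∈fz x∈ey
      ...   | inj₂ (inj₁ refl)               = e , e∈A , endpoint e z
      ...   | inj₂ (inj₂ (g , g∈ef , g∈zx)) with z ≟ g
      ...     | no z≢g   = g , A-closed e f e∈A f∈A g∈ef ,
                           reversal z x g (symm z g x g∈zx z≢g)
      ...     | yes refl = x , x∈A , startpoint x z
        where
        z∈A = A-closed e f e∈A f∈A g∈ef
        y∈A = A-closed f z f∈A z∈A y∈fz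
        x∈A = A-closed e y e∈A y∈A x∈ey

      joinTransitive : IsJoinTransitive X
      joinTransitive x y = From-transitive (join X x y) (closed x y)

      module _ {q} (A : Pred Carrier q) (A-closed : IsJoinClosed A) (x : Carrier) where

        -- Write ≤ for `From X A`. The lines ep and fq meet at `x`, so ef and qp meet in some `g` in
        -- `A`. If `g` differs from `q`, then pq ⊆ gq, so z ≤ q ≤ x; if not, `q` is in `A` and z ≤ p
        -- ≤ x.
        below-joinClosed : IsJoinClosed (λ z → From X A z x)
        below-joinClosed p q (e , e∈A , p∈ex) (f , f∈A , q∈fx) {z} z∈pq
          with e ≟ p | f ≟ q
        ... | yes refl | _ =
          From-transitive A A-closed (p , e∈A , z∈pq) (f , f∈A , q∈fx)
        ... | no _ | yes refl =
          From-transitive A A-closed (q , f∈A , reversal p z q z∈pq) (e , e∈A , p∈ex)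
        ... | no e≢p | no f≢q
          with veblen e f q p
                 (inj₂ (inj₂ (x , symm f q x q∈fx f≢q , symm e p x p∈ex e≢p)))
        ...   | inj₁ refl        = e , e∈A , closed e x p q p∈ex q∈fx z∈pq
        ...   | inj₂ (inj₁ refl) with refl ← collapse p z z∈pq = e , e∈A , p∈ex
        ...   | inj₂ (inj₂ (g , g∈ef , g∈qp)) with q ≟ g
        ...     | yes refl =
          From-transitive A A-closed
            (q , A-closed e f e∈A f∈A g∈ef , reversal p z q z∈pq) (e , e∈A , p∈ex)
        ...     | no q≢g =
          From-transitive A A-closed (g , A-closed e f e∈A f∈A g∈ef , z∈gq)
            (f , f∈A , q∈fx)
          where
          z∈gq : ⟨ g , z , q ⟩
          z∈gq = reversal q z g
            (trans q p g (symm q g p g∈qp q≢g) (reversal p z q z∈pq))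

        -- The disjunct `z ≡ x` keeps `x` in the cone when `A` is empty.
        Cone : Pred Carrier (a ⊔ r ⊔ q)
        Cone z = z ≡ x ⊎ From X A z x

        cone-joinClosed : IsJoinClosed Cone
        cone-joinClosed p q (inj₁ refl) (inj₁ refl) z∈pq =
          inj₁ (collapse p _ z∈pq)
        cone-joinClosed p q (inj₁ refl) (inj₂ (f , f∈A , q∈fx)) z∈pq =
          inj₂ (f , f∈A , reversal p _ f (trans p q f (reversal f q p q∈fx) z∈pq))
        cone-joinClosed p q (inj₂ (e , e∈A , p∈ex)) (inj₁ refl) {z} z∈pq =
          inj₂ (e , e∈A , reversal q _ e
            (trans q p e (reversal e p q p∈ex) (reversal p z q z∈pq)))
        cone-joinClosed p q (inj₂ p≤x) (inj₂ q≤x) z∈pq =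
          inj₂ (below-joinClosed p q p≤x q≤x z∈pq)

        ∪-⊆-cone : A ∪ ｛ x ｝ ⊆ Cone
        ∪-⊆-cone {z} (inj₁ z∈A) = inj₂ (z , z∈A , startpoint z x)
        ∪-⊆-cone (inj₂ x≡z)     = inj₁ (sym x≡z)

      joinClosed-isExchange : IsExchange (JoinClosed X)
      joinClosed-isExchange A A-closed x y x∉A y∉A x⊢y (S , S-closed , A∪y⊆S)
        with x⊢y (Cone A A-closed x , cone-joinClosed A A-closed x , ∪-⊆-cone A A-closed x)
      ... | inj₁ refl             = A∪y⊆S (inj₂ refl)
      -- Since `y` is outside `A`, it differs from `e`; symmetry then puts `x` on ey, which lies in
      -- `S`.
      ... | inj₂ (e , e∈A , y∈ex) =
        S-closed e y (A∪y⊆S (inj₁ e∈A)) (A∪y⊆S (inj₂ refl))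
          (symm e y x y∈ex λ { refl → y∉A e∈A })

      joinClosed-isMatroid : IsMatroid (JoinClosed X)
      joinClosed-isMatroid = record
        { isClosureSpace  = joinClosed-isClosureSpace
        ; isExchange      = joinClosed-isExchange
        ; isCombinatorial = joinClosed-isCombinatorial
        }

    module JoinTransitive (joinTransitive : IsJoinTransitive X) where

      transitive : IsTransitive X
      transitive x y z y∈xz w∈xy
        with joinTransitive x x (x , endpoint x x , w∈xy) (x , endpoint x x , y∈xz)
      ... | e , e∈xx , w∈ez with refl ← collapse x e e∈xx = w∈ez

      -- Symmetry is not yet available. For the relation ≤ over xp, z ≤ q ≤ y gives `g` on xp ⊆ xy
      -- with z ∈ gy ⊆ xy.
      join-joinClosed′ : ∀ x y → IsJoinClosed (join X x y)
      join-joinClosed′ x y p q p∈xy q∈xy {z} z∈pq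
        with joinTransitive x p (p , endpoint x p , z∈pq) (x , startpoint x p , q∈xy)
      ... | g , g∈xp , z∈gy =
        reversal y z x (transitive y g x (reversal x g y g∈xy) (reversal g z y z∈gy))
        where
        g∈xy : ⟨ x , g , y ⟩
        g∈xy = transitive x p y p∈xy g∈xp

      symmetric : IsExchange (JoinClosed X) → IsSymmetric X
      symmetric exchange x y z y∈xz x≢y =
        -- Exchange over {x} gives y ⊢ z, which is evaluated at the closed set xy, lifted to the
        -- level of `JoinClosed`.
        lower (exchange A A-closed z y z∉A (x≢y ∘ sym ∘ lower) z⊢y
          ((λ w → Lift a (⟨ x , w , y ⟩)) ,
           (λ { p q (lift p∈xy) (lift q∈xy) w∈pq →
                lift (join-joinClosed′ x y p q p∈xy q∈xy w∈pq) }) ,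
           λ { (inj₁ (lift refl)) → lift (startpoint x y)
             ; (inj₂ refl)        → lift (endpoint x y) }))
        where
        A : Pred Carrier (a ⊔ r)
        A w = Lift r (w ≡ x)
        A-closed : JoinClosed X A
        A-closed p q (lift refl) (lift refl) w∈pq = lift (collapse p _ w∈pq)
        z∉A : z ∈ A → _
        z∉A (lift refl) = x≢y (sym (collapse x y y∈xz))
        z⊢y : Entails (JoinClosed X) A z y
        z⊢y (S , S-closed , A∪z⊆S) =
          S-closed x z (A∪z⊆S (inj₁ (lift refl))) (A∪z⊆S (inj₂ refl)) y∈xz

      module _ (symm : IsSymmetric X) where

        veblen : ∀ x y z w → Satisfiable (join X y z ∩ join X x w) → z ≢ w → x ≢ y →
                 Satisfiable (join X x y ∩ join X z w)
        veblen x y z w (e , e∈yz , e∈xw) z≢w x≢y with y ≟ e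
        -- Here `y` lies on xw, so `w` itself is the common point.
        ... | yes refl = w , symm x y w e∈xw x≢y , endpoint z w
        ... | no y≢e
          -- The step z ≤ e over xy has witness `y`, as symmetry gives z ∈ ye; the step e ≤ w has
          -- witness `x`.
          with joinTransitive x y (y , endpoint x y , symm y e z e∈yz y≢e)
                                  (x , startpoint x y , e∈xw)
        ...   | g , g∈xy , z∈gw =
          g , g∈xy , reversal w g z (symm w z g (reversal g z w z∈gw) (z≢w ∘ sym))

        preprojective : IsPreprojective X
        preprojective = (transitive , symm) , meet
          where
          meet : ∀ x y z w → y ≡ z ⊎ x ≡ w ⊎ Satisfiable (join X y z ∩ join X x w) →
                 x ≡ y ⊎ z ≡ w ⊎ Satisfiable (join X x y ∩ join X z w)
          meet x y z w (inj₁ refl) =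
            inj₂ (inj₂ (y , endpoint x y , startpoint y w))
          meet x y z w (inj₂ (inj₁ refl)) =
            inj₂ (inj₂ (x , startpoint x y , endpoint z x))
          meet x y z w (inj₂ (inj₂ common)) with x ≟ y | z ≟ w
          ... | yes x≡y | _       = inj₁ x≡y
          ... | no _    | yes z≡w = inj₂ (inj₁ z≡w)
          ... | no x≢y  | no z≢w  = inj₂ (inj₂ (veblen x y z w common z≢w x≢y))

corollary6p5 : ∀ {a r : Level} → ExcludedMiddle (suc (a ⊔ r)) → (X : JoinSpace a r) →
    IsProjective X ⇔ (IsDense X × IsJoinTransitive X × IsMatroid (JoinClosed X))
corollary6p5 {a} {r} em X = mk⇔
  (λ (preproj , dense) →
    let open Preprojective X _≟_ preproj
    in dense , joinTransitive , joinClosed-isMatroid)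
  (λ (dense , joinTrans , matroid) →
    let open JoinTransitive X _≟_ joinTrans
    in preprojective (symmetric (IsMatroid.isExchange matroid)) , dense)
  where
  _≟_ : DecidableEquality (JoinSpace.Carrier X)
  -- Excluded middle enters only here, to decide equality of points.
  x ≟ y = map′ lower lift (em {Lift (suc (a ⊔ r)) (x ≡ y)})
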